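{- Let $k\geq 1$ be an integer. For every natural number $n\geq 1$, $\sigma_k(B_n)\leq B_{\sigma_k(n)}$, and equality holds only if $n=1$.
   Context: The balancing numbers $(B_n)_{n\geq 0}$ are defined by $B_0=0$, $B_1=1$, $B_{n+1}=6B_n-B_{n-1}$ for $n\geq 1$ (so $B_n=\frac{\alpha^n-\beta^n}{\alpha-\beta}$ with $\alpha=3+2\sqrt2$, $\beta=3-2\sqrt2$). For a positive integer $m$, $\sigma_k(m)$ denotes the sum of the $k$-th powers of the positive divisors of $m$. -}

module Defs where

open import Data.List using (List; applyUpTo; filter; map)
open import Data.Nat using (ℕ; zero; suc; _+_; _*_; _∸_; _^_; _≤_; z≤n)
open import Data.Nat.Divisibility using (_∣?_)
open import Data.Nat.ListAction using (sum)
open import Data.Nat.Properties using (≤-trans; ∸-monoʳ-≤; m≤m+n; m+n∸m≡n; m∸n+n≡m)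
open import Relation.Binary.PropositionalEquality using (_≡_; subst; sym)

-- The truncated subtraction never truncates: see B-recurrence.
B : ℕ → ℕ
B zero          = 0
B (suc zero)    = 1
B (suc (suc n)) = 6 * B (suc n) ∸ B n

B-mono : ∀ n → B n ≤ B (suc n)
B-mono zero    = z≤n
B-mono (suc n) = ≤-trans
  (subst (B (suc n) ≤_) (sym (m+n∸m≡n (B (suc n)) (5 * B (suc n)))) (m≤m+n _ _))
  (∸-monoʳ-≤ (6 * B (suc n)) (B-mono n))

B-recurrence : ∀ n → B (suc (suc n)) + B n ≡ 6 * B (suc n)
B-recurrence n = m∸n+n≡m (≤-trans (B-mono n) (m≤m+n _ _))

-- The positive divisors of m, for m ≥ 1, each listed once: those d in 1, …, m with d ∣ m.
divisors : ℕ → List ℕ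
divisors m = filter (_∣? m) (applyUpTo suc m)

σ : ℕ → ℕ → ℕ
σ k m = sum (map (_^ k) (divisors m))

{-# OPTIONS --safe #-}
-- For n ≥ 2 the inequality is strict. If k ≥ 2, the trivial bounds
-- σ_k(m) ≤ m^(k+1), B_a B_b ≤ B_(a+b) and σ_k(n) ≥ 1 + n^k suffice, except at
-- k = n = 2. Let k = 1, and recall that B_(i+1) ≥ 5 B_i.
--
-- If n is composite with a largest proper divisor a, then a² ≥ n and
-- σ(n) ≥ 1 + a + n, so B_(σ(n)) / B_n ≥ 5^(a+1), whereas the harmonic bound
-- σ(m) ≤ m (1 + log₂ m) gives σ(B_n) / B_n = O(a²).
--
-- If n is prime, then σ(n) = n + 1 and one has to show that B_n has no small
-- prime factor. If p ∣ B_n then p ∤ B_i for 0 < i < n, and the n - 1 ratios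
-- B_(i+1) / B_i mod p are distinct, because
-- B_(i+1) B_(i+e) - B_i B_(i+e+1) = B_e. Hence p ≥ P := n - 1. As B_n ≤ 6^P,
-- there are at most P prime factors when P ≥ 6, and therefore
-- σ(B_n) / B_n ≤ (1 + 1/P)^P ≤ 3 < 5.
module Submission where

open import Defs
open import Data.Fin.Base as Fin using (Fin; toℕ; fromℕ<)
open import Data.Fin.Properties using (pigeonhole; toℕ<n; toℕ-fromℕ<)
open import Data.List.Base using ([]; _∷_; _++_; map; applyUpTo; length)
open import Data.List.Membership.Propositional using (_∈_)
open import Data.List.Membership.Propositional.Properties using (∈-∃++; ∈-++⁺ˡ; ∈-++⁺ʳ; ∈-++⁻; ∈-map⁺; ∈-filter⁺; ∈-filter⁻; ∈-applyUpTo⁺)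
open import Data.List.Properties using (map-cong; map-id; length-applyUpTo; length-filter)
open import Data.List.Relation.Binary.Permutation.Propositional.Properties using (map⁺; shift)
open import Data.List.Relation.Unary.All as All using (All; []; _∷_)
open import Data.List.Relation.Unary.AllPairs using ([]; _∷_)
open import Data.List.Relation.Unary.Any using (here; there)
open import Data.List.Relation.Unary.Unique.Propositional using (Unique)
open import Data.List.Relation.Unary.Unique.Propositional.Properties using (applyUpTo⁺₁; filter⁺)
open import Data.Nat
open import Data.Nat.Coprimality using (Coprime; coprime-Bézout; prime⇒coprime)
open import Data.Nat.Divisibility
open import Data.Nat.DivMod using (_/_; _%_; m≡m%n+[m/n]*n; m%n<n; m*n/n≡m; m/n*n≤m; /-monoʳ-≤)
open import Data.Nat.GCD using (module Bézout)
open import Data.Nat.ListAction using (sum; product)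
open import Data.Nat.ListAction.Properties using (sum-++; sum-↭; ∈⇒∣product)
open import Data.Nat.Primality using (Prime; prime; Composite; composite; composite?; composite[4]; composite[6]; euclidsLemma; prime⇒nonZero; prime⇒irreducible)
open import Data.Nat.Primality.Factorisation using (PrimeFactorisation; factorise)
open import Data.Nat.Properties
open import Data.Nat.Tactic.RingSolver using (solve-∀)
open import Data.Product using (_×_; _,_; proj₁; proj₂; ∃)
open import Data.Sum using (inj₁; inj₂)
open import Function using (_∘_; id)
open import Relation.Binary.PropositionalEquality using (_≡_; _≢_; refl; sym; trans; cong; cong₂; subst; subst₂; module ≡-Reasoning)
open import Relation.Nullary using (¬_; yes; no; contradiction)
open import Relation.Nullary.Decidable using (from-yes)

-- Balancing numbers

-- The difference `B (suc i) * B (i + e) - B i * B (suc (i +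
-- e))` does not change when `i` grows by one, by the recurrence at `i` and at `i + e`, and at `i =
-- 0` it is `B e`. The additive form avoids truncated subtraction.
B-d'Ocagne : ∀ i e → B (suc i) * B (i + e) ≡ B i * B (suc (i + e)) + B e
B-d'Ocagne zero    e = +-identityʳ (B e)
-- Adding `x * w` to both sides lets the recurrence enter as the sum `z + x`.
B-d'Ocagne (suc i) e = +-cancelʳ-≡ (x * w) _ _ (begin
  z * w + x * w            ≡⟨ *-distribʳ-+ w z x ⟨
  (z + x) * w              ≡⟨ cong (_* w) (B-recurrence i) ⟩
  6 * y * w                ≡⟨ swap y w ⟩
  y * (6 * w)              ≡⟨ cong (y *_) (B-recurrence (i + e)) ⟨
  y * (v + B (i + e))      ≡⟨ *-distribˡ-+ y v (B (i + e)) ⟩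
  y * v + y * B (i + e)    ≡⟨ cong (y * v +_) (B-d'Ocagne i e) ⟩
  y * v + (x * w + B e)    ≡⟨ move (y * v) (x * w) (B e) ⟩
  y * v + B e + x * w      ∎)
  where
  open ≡-Reasoning
  x = B i
  y = B (suc i)
  z = B (suc (suc i))
  w = B (suc (i + e))
  v = B (suc (suc (i + e)))
  swap : ∀ u w → 6 * u * w ≡ u * (6 * w)
  swap = solve-∀
  move : ∀ a b c → a + (b + c) ≡ a + c + b
  move = solve-∀

-- Induction on `a` shifts one unit of the index from `a` to `b`; the recurrence is used once on
-- each side.
B-addition : ∀ a b → B (suc (a + b)) + B a * B b ≡ B (suc a) * B (suc b)
B-addition zero    b = refl
B-addition (suc a) b = +-cancelʳ-≡ (B a * B (suc b)) _ _ (begin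
  s + y * B b + B a * z          ≡⟨ move s (y * B b) (B a * z) ⟩
  s + B a * z + y * B b          ≡⟨ cong (λ t → B (suc t) + B a * z + y * B b) (+-suc a b) ⟨
  B (suc (a + suc b)) + B a * z + y * B b  ≡⟨ cong (_+ y * B b) (B-addition a (suc b)) ⟩
  y * B (suc (suc b)) + y * B b  ≡⟨ *-distribˡ-+ y _ _ ⟨
  y * (B (suc (suc b)) + B b)    ≡⟨ cong (y *_) (B-recurrence b) ⟩
  y * (6 * z)                    ≡⟨ swap y z ⟩
  6 * y * z                      ≡⟨ cong (_* z) (B-recurrence a) ⟨
  (B (suc (suc a)) + B a) * z    ≡⟨ *-distribʳ-+ z (B (suc (suc a))) (B a) ⟩
  B (suc (suc a)) * z + B a * z  ∎)
  where
  open ≡-Reasoning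
  s = B (suc (suc (a + b)))
  y = B (suc a)
  z = B (suc b)
  move : ∀ a b c → a + b + c ≡ a + c + b
  move = solve-∀
  swap : ∀ u z → u * (6 * z) ≡ 6 * u * z
  swap = solve-∀

B-suc-≤ : ∀ n → B (suc (suc n)) ≤ 6 * B (suc n)
B-suc-≤ n = ≤-trans (m≤m+n _ (B n)) (≤-reflexive (B-recurrence n))

B-suc-≥ : ∀ n → 5 * B n ≤ B (suc n)
B-suc-≥ zero    = z≤n
B-suc-≥ (suc n) = +-cancelʳ-≤ (B n) _ _ (begin
  5 * B (suc n) + B n          ≤⟨ +-monoʳ-≤ (5 * B (suc n)) (B-mono n) ⟩
  5 * B (suc n) + B (suc n)    ≡⟨ +-comm (5 * B (suc n)) _ ⟩
  6 * B (suc n)                ≡⟨ B-recurrence n ⟨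
  B (suc (suc n)) + B n        ∎)
  where open ≤-Reasoning

B-pos : ∀ n → 0 < B (suc n)
B-pos zero    = z<s
B-pos (suc n) = ≤-trans (B-pos n) (B-mono (suc n))

B-< : ∀ n → B n < B (suc n)
B-< zero    = z<s
B-< (suc n) = <-≤-trans (m<m+n (B (suc n)) (*-mono-≤ {1} {4} z<s (B-pos n))) (B-suc-≥ (suc n))

B-mono-≤ : ∀ {m n} → m ≤ n → B m ≤ B n
B-mono-≤ = go ∘ ≤⇒≤′
  where
  go : ∀ {m n} → m ≤′ n → B m ≤ B n
  go ≤′-refl           = ≤-refl
  go (≤′-step {n} m≤n) = ≤-trans (go m≤n) (B-mono n)

B-mono-< : ∀ {m n} → m < n → B m < B n
B-mono-< {m} m<n = <-≤-trans (B-< m) (B-mono-≤ m<n)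

B≤6^ : ∀ n → B (suc n) ≤ 6 ^ n
B≤6^ zero    = ≤-refl
B≤6^ (suc n) = ≤-trans (B-suc-≤ n) (*-monoʳ-≤ 6 (B≤6^ n))

5^*B≤B : ∀ a n → 5 ^ a * B n ≤ B (a + n)
5^*B≤B zero    n = ≤-reflexive (+-identityʳ (B n))
5^*B≤B (suc a) n = begin
  5 * 5 ^ a * B n    ≡⟨ *-assoc 5 (5 ^ a) (B n) ⟩
  5 * (5 ^ a * B n)  ≤⟨ *-monoʳ-≤ 5 (5^*B≤B a n) ⟩
  5 * B (a + n)      ≤⟨ B-suc-≥ (a + n) ⟩
  B (suc (a + n))    ∎
  where open ≤-Reasoning

-- By the addition formula and induction the product is at most the sum of two earlier terms, and
-- the growth factor 5 leaves ample room for that sum.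
B*B≤B : ∀ a b → B a * B b ≤ B (a + b)
B*B≤B zero    b       = z≤n
B*B≤B (suc a) zero    = ≤-trans (≤-reflexive (*-zeroʳ (B (suc a)))) z≤n
B*B≤B (suc a) (suc b) = begin
  B (suc a) * B (suc b)               ≡⟨ B-addition a b ⟨
  B (suc (a + b)) + B a * B b         ≤⟨ +-monoʳ-≤ (B (suc (a + b))) (B*B≤B a b) ⟩
  B (suc (a + b)) + B (a + b)         ≤⟨ +-monoʳ-≤ (B (suc (a + b))) (≤-trans (B-mono (a + b)) (m≤m+n _ _)) ⟩
  5 * B (suc (a + b))                 ≤⟨ B-suc-≥ (suc (a + b)) ⟩
  B (suc (suc (a + b)))               ≡⟨ cong (B ∘ suc) (+-suc a b) ⟨
  B (suc a + suc b)                   ∎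
  where open ≤-Reasoning

B^≤B : ∀ n j → B n ^ suc j ≤ B (suc j * n)
B^≤B n zero    = ≤-reflexive (trans (*-identityʳ (B n)) (cong B (sym (+-identityʳ n))))
B^≤B n (suc j) = ≤-trans (*-monoʳ-≤ (B n) (B^≤B n j)) (B*B≤B n (suc j * n))

-- Prime divisors of balancing numbers

∣m+n∣n⇒∣m : ∀ {d m n} → d ∣ m + n → d ∣ n → d ∣ m
∣m+n∣n⇒∣m {d} {m} {n} d∣m+n = ∣m+n∣m⇒∣n (subst (d ∣_) (+-comm m n) d∣m+n)

∣B-+ : ∀ {d} a b → d ∣ B a → d ∣ B b → d ∣ B (a + b)
∣B-+ {d} a zero    d∣a _   = subst (λ t → d ∣ B t) (sym (+-identityʳ a)) d∣a
∣B-+ {d} a (suc b) d∣a d∣b = subst (λ t → d ∣ B t) (sym (+-suc a b))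
  (∣m+n∣n⇒∣m (subst (d ∣_) (sym (B-addition a b)) (∣n⇒∣m*n (B (suc a)) d∣b))
             (∣m⇒∣m*n (B b) d∣a))

∣B-* : ∀ {d} x a → d ∣ B a → d ∣ B (x * a)
∣B-* zero    a _   = _ ∣0
∣B-* (suc x) a d∣a = ∣B-+ a (x * a) d∣a (∣B-* x a d∣a)

-- For `e = 1` the d'Ocagne identity exhibits 1 as a combination of `B n` and `B (suc n)`.
∣B-consecutive : ∀ {d} n → d ∣ B n → d ∣ B (suc n) → d ≡ 1
∣B-consecutive {d} n d∣n d∣1+n = ∣1⇒≡1 (∣m+n∣m⇒∣n
  (subst (d ∣_) (B-d'Ocagne n 1) (∣m⇒∣m*n (B (n + 1)) d∣1+n))
  (∣m⇒∣m*n (B (suc (n + 1))) d∣n))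

-- Bézout gives a multiple of `m` and a multiple of `n` that are consecutive, and `d` divides `B` at
-- both.
B-coprime : ∀ {m n d} → Coprime m n → d ∣ B m → d ∣ B n → d ≡ 1
B-coprime {m} {n} {d} c d∣m d∣n with coprime-Bézout c
... | Bézout.+- x y eq = ∣B-consecutive (y * n) (∣B-* y n d∣n) (subst (λ t → d ∣ B t) (sym eq) (∣B-* x m d∣m))
... | Bézout.-+ x y eq = ∣B-consecutive (x * m) (∣B-* x m d∣m) (subst (λ t → d ∣ B t) (sym eq) (∣B-* y n d∣n))

-- The residue - b / a: with this sign the congruence needs no subtraction.
root : ∀ {p a} .{{_ : NonZero p}} → Coprime p a → ∀ b → ∃ λ (r : Fin p) → p ∣ a * toℕ r + b
root {suc q} {a} c b = reduce (unreduced (coprime-Bézout c))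
  where
  p = suc q
  unreduced : Bézout.Identity 1 p a → ∃ λ r → p ∣ a * r + b
  unreduced (Bézout.+- x y eq) = y * b , divides (x * b) (trans (shape a y b) (trans (cong (_* b) eq) (swap x p b)))
    where
    shape : ∀ a y b → a * (y * b) + b ≡ (1 + y * a) * b
    shape = solve-∀
    swap : ∀ x p b → x * p * b ≡ x * b * p
    swap = solve-∀
  -- Here `y` inverts `a` modulo `p`, so the factor `q`, congruent to -1, supplies the sign.
  unreduced (Bézout.-+ x y eq) = y * (b * q) , divides (b + x * (b * q)) (trans (shape a y b q) (trans (cong (λ t → t * (b * q) + b) (sym eq)) (collect x q b)))
    where
    shape : ∀ a y b q → a * (y * (b * q)) + b ≡ y * a * (b * q) + b
    shape = solve-∀
    collect : ∀ x q b → (1 + x * (1 + q)) * (b * q) + b ≡ (b + x * (b * q)) * (1 + q)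
    collect = solve-∀
  reduce : (∃ λ r → p ∣ a * r + b) → ∃ λ (r : Fin p) → p ∣ a * toℕ r + b
  reduce (r , p∣) = fromℕ< (m%n<n r p) , subst (λ t → p ∣ a * t + b) (sym (toℕ-fromℕ< (m%n<n r p)))
    (∣m+n∣n⇒∣m (subst (p ∣_) (trans (cong (λ t → a * t + b) (m≡m%n+[m/n]*n r p)) (shape a (r % p) (r / p * p) b)) p∣)
               (∣n⇒∣m*n a (n∣m*n (r / p))))
    where
    shape : ∀ a u v b → a * (u + v) + b ≡ (a * u + b) + a * v
    shape = solve-∀

-- Eliminating `r` from the two relations leaves exactly the d'Ocagne difference `B e`.
same-root⇒∣B : ∀ {p} i e r → p ∣ B i * r + B (suc i) → p ∣ B (i + e) * r + B (suc (i + e)) → p ∣ B e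
same-root⇒∣B {p} i e r p∣i p∣j = ∣m+n∣m⇒∣n
  (subst (p ∣_) eq (∣n⇒∣m*n (B (i + e)) p∣i)) (∣n⇒∣m*n (B i) p∣j)
  where
  open ≡-Reasoning
  shape₁ : ∀ a b a' r → a' * (a * r + b) ≡ a * a' * r + b * a'
  shape₁ = solve-∀
  shape₂ : ∀ a a' b' r e → a * a' * r + (a * b' + e) ≡ a * (a' * r + b') + e
  shape₂ = solve-∀
  eq : B (i + e) * (B i * r + B (suc i)) ≡ B i * (B (i + e) * r + B (suc (i + e))) + B e
  eq = begin
    B (i + e) * (B i * r + B (suc i))                        ≡⟨ shape₁ (B i) (B (suc i)) (B (i + e)) r ⟩
    B i * B (i + e) * r + B (suc i) * B (i + e)              ≡⟨ cong (B i * B (i + e) * r +_) (B-d'Ocagne i e) ⟩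
    B i * B (i + e) * r + (B i * B (suc (i + e)) + B e)      ≡⟨ shape₂ (B i) (B (i + e)) (B (suc (i + e))) r (B e) ⟩
    B i * (B (i + e) * r + B (suc (i + e))) + B e            ∎

-- If `p < n`, two of the `n` residues agree by the pigeonhole principle, and `p` divides `B e` for
-- the distance `e` of their indices. This contradicts `B-coprime`, since `0 < e < suc n` and
-- `suc n` is prime.
prime∣B[prime]⇒≥ : ∀ {n p} → Prime (suc n) → Prime p → p ∣ B (suc n) → n ≤ p
prime∣B[prime]⇒≥ {n} {p} n-prime p-prime p∣B = ≮⇒≥ λ p<n → collision (pigeonhole p<n (proj₁ ∘ residue))
  where
  instance _ = prime⇒nonZero p-prime
  p≢1 : p ≢ 1
  p≢1 refl = contradiction p-prime λ ()
  p∤B : ∀ i → .{{NonZero i}} → i < suc n → ¬ p ∣ B i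
  p∤B i i<n p∣ = p≢1 (B-coprime (prime⇒coprime n-prime i<n) p∣B p∣)
  coprime : ∀ i → .{{NonZero i}} → i < suc n → Coprime p (B i)
  coprime i i<n (d∣p , d∣B) with prime⇒irreducible p-prime d∣p
  ... | inj₁ d≡1  = d≡1
  ... | inj₂ refl = contradiction d∣B (p∤B i i<n)
  -- The indices start at 1, because `B 0` is 0 and has no inverse modulo `p`.
  residue : ∀ (i : Fin n) → ∃ λ (r : Fin p) → p ∣ B (suc (toℕ i)) * toℕ r + B (suc (suc (toℕ i)))
  residue i = root (coprime (suc (toℕ i)) (s<s (toℕ<n i))) _
  collision : ¬ (∃ λ i → ∃ λ j → i Fin.< j × proj₁ (residue i) ≡ proj₁ (residue j))
  collision (i , j , i<j , eq) = p∤B e {{>-nonZero (m<n⇒0<n∸m i<j)}}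
    (s≤s (≤-trans (m∸n≤m (toℕ j) (toℕ i)) (<⇒≤ (toℕ<n j))))
    (same-root⇒∣B (suc (toℕ i)) e (toℕ (proj₁ (residue i))) (proj₂ (residue i))
      (subst₂ (λ t r → p ∣ B (suc t) * toℕ r + B (suc (suc t))) (sym (m+[n∸m]≡n (<⇒≤ i<j))) (sym eq) (proj₂ (residue j))))
    where e = toℕ j ∸ toℕ i

-- Divisor sums

-- Each entry of `xs` is cancelled against one occurrence in `ys`; since `xs` has no repetitions,
-- its other entries survive in the rest of `ys`.
sum-map-≤-sum-map : ∀ (f : ℕ → ℕ) {xs ys} → Unique xs → (∀ {x} → x ∈ xs → x ∈ ys) → sum (map f xs) ≤ sum (map f ys)
sum-map-≤-sum-map f {[]}     _          _     = z≤n
sum-map-≤-sum-map f {x ∷ xs} (x∉ ∷ xs!) xs⊆ys with us , vs , refl ← ∈-∃++ (xs⊆ys (here refl)) = begin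
  f x + sum (map f xs)          ≤⟨ +-monoʳ-≤ (f x) (sum-map-≤-sum-map f xs! xs⊆us++vs) ⟩
  f x + sum (map f (us ++ vs))  ≡⟨ sum-↭ (map⁺ f (shift x us vs)) ⟨
  sum (map f (us ++ x ∷ vs))    ∎
  where
  open ≤-Reasoning
  xs⊆us++vs : ∀ {y} → y ∈ xs → y ∈ us ++ vs
  xs⊆us++vs y∈xs with ∈-++⁻ us (xs⊆ys (there y∈xs))
  ... | inj₁ y∈us         = ∈-++⁺ˡ y∈us
  ... | inj₂ (here refl)  = contradiction refl (All.lookup x∉ y∈xs)
  ... | inj₂ (there y∈vs) = ∈-++⁺ʳ us y∈vs

sum-map-≤-length : ∀ (f : ℕ → ℕ) xs c → (∀ {x} → x ∈ xs → f x ≤ c) → sum (map f xs) ≤ length xs * c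
sum-map-≤-length f []       c _  = z≤n
sum-map-≤-length f (x ∷ xs) c f≤ = +-mono-≤ (f≤ (here refl)) (sum-map-≤-length f xs c (f≤ ∘ there))

∈-divisors⁺ : ∀ {d m} .{{_ : NonZero m}} → d ∣ m → d ∈ divisors m
∈-divisors⁺ {zero}  {m} 0∣m = contradiction (0∣⇒≡0 0∣m) (≢-nonZero⁻¹ m)
∈-divisors⁺ {suc d} {m} d∣m = ∈-filter⁺ (_∣? m) (∈-applyUpTo⁺ suc (∣⇒≤ d∣m)) d∣m

∈-divisors⁻ : ∀ {d m} → d ∈ divisors m → d ∣ m
∈-divisors⁻ {m = m} = proj₂ ∘ ∈-filter⁻ (_∣? m) {xs = applyUpTo suc m}

divisors-unique : ∀ m → Unique (divisors m)
divisors-unique m = filter⁺ (_∣? m) (applyUpTo⁺₁ suc m λ i<j _ → <⇒≢ i<j ∘ suc-injective)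

sum≤σ : ∀ k {m} .{{_ : NonZero m}} {ds} → Unique ds → All (_∣ m) ds → sum (map (_^ k) ds) ≤ σ k m
sum≤σ k ds! ds∣m = sum-map-≤-sum-map (_^ k) ds! (∈-divisors⁺ ∘ All.lookup ds∣m)

σ≥1+^ : ∀ k {n} → 2 ≤ n → 1 + n ^ k ≤ σ k n
σ≥1+^ k {n} 2≤n = begin
  1 + n ^ k              ≡⟨ cong₂ _+_ (sym (^-zeroˡ k)) (sym (+-identityʳ (n ^ k))) ⟩
  1 ^ k + (n ^ k + 0)    ≤⟨ sum≤σ k {{>-nonZero (≤-trans z<s 2≤n)}} {1 ∷ n ∷ []}
                               ((<⇒≢ 2≤n ∷ []) ∷ [] ∷ []) (1∣ n ∷ ∣-refl ∷ []) ⟩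
  σ k n                  ∎
  where open ≤-Reasoning

σ₁≥ : ∀ {a n} → 1 < a → a < n → a ∣ n → suc a + n ≤ σ 1 n
σ₁≥ {a} {n} 1<a a<n a∣n = begin
  suc a + n                  ≡⟨ shape a n ⟩
  1 ^ 1 + (a ^ 1 + (n ^ 1 + 0))  ≤⟨ sum≤σ 1 {{>-nonZero (≤-trans z<s a<n)}} {1 ∷ a ∷ n ∷ []}
                                  ((<⇒≢ 1<a ∷ <⇒≢ (<-trans 1<a a<n) ∷ []) ∷ (<⇒≢ a<n ∷ []) ∷ [] ∷ [])
                                  (1∣ n ∷ a∣n ∷ ∣-refl ∷ []) ⟩
  σ 1 n                      ∎
  where
  open ≤-Reasoning
  shape : ∀ a n → suc a + n ≡ 1 + (a * 1 + (n * 1 + 0))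
  shape = solve-∀

σ≤^ : ∀ k m .{{_ : NonZero m}} → σ k m ≤ m ^ suc k
σ≤^ k m = begin
  σ k m                         ≤⟨ sum-map-≤-length (_^ k) (divisors m) (m ^ k) (^-monoˡ-≤ k ∘ ∣⇒≤ ∘ ∈-divisors⁻) ⟩
  length (divisors m) * m ^ k   ≤⟨ *-monoˡ-≤ (m ^ k) (length-filter (_∣? m) (applyUpTo suc m)) ⟩
  length (applyUpTo suc m) * m ^ k  ≡⟨ cong (_* m ^ k) (length-applyUpTo suc m) ⟩
  m * m ^ k                     ∎
  where open ≤-Reasoning

σ₁≡sum : ∀ m → σ 1 m ≡ sum (divisors m)
σ₁≡sum m = cong sum (trans (map-cong *-identityʳ (divisors m)) (map-id (divisors m)))

-- Upper bounds come from lists that cover the divisors, possibly with repetitions or extra entries.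
sum-divisors≤ : ∀ {m ys} → (∀ {d} → d ∣ m → d ∈ ys) → sum (divisors m) ≤ sum ys
sum-divisors≤ {m} {ys} ⊆ys = subst₂ (λ ds es → sum ds ≤ sum es) (map-id (divisors m)) (map-id ys)
  (sum-map-≤-sum-map id (divisors-unique m) (⊆ys ∘ ∈-divisors⁻))

sum-map-* : ∀ c xs → sum (map (c *_) xs) ≡ c * sum xs
sum-map-* c []       = sym (*-zeroʳ c)
sum-map-* c (x ∷ xs) = trans (cong (c * x +_) (sum-map-* c xs)) (sym (*-distribˡ-+ c x (sum xs)))

-- A divisor of p m divides m or is p times a divisor of m.
σ₁-prime* : ∀ {p} m .{{_ : NonZero m}} → Prime p → σ 1 (p * m) ≤ suc p * σ 1 m
σ₁-prime* {p} m p-prime = begin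
  σ 1 (p * m)                          ≡⟨ σ₁≡sum (p * m) ⟩
  sum (divisors (p * m))               ≤⟨ sum-divisors≤ split ⟩
  sum (D ++ map (p *_) D)              ≡⟨ sum-++ D _ ⟩
  sum D + sum (map (p *_) D)           ≡⟨ cong (sum D +_) (sum-map-* p D) ⟩
  suc p * sum D                        ≡⟨ cong (suc p *_) (σ₁≡sum m) ⟨
  suc p * σ 1 m                        ∎
  where
  open ≤-Reasoning
  instance _ = prime⇒nonZero p-prime
  D = divisors m
  split : ∀ {d} → d ∣ p * m → d ∈ D ++ map (p *_) D
  split {d} (divides q pm≡qd) with euclidsLemma q d p-prime (subst (p ∣_) pm≡qd (m∣m*n m))
  ... | inj₁ (divides-refl r) = ∈-++⁺ˡ (∈-divisors⁺ (divides r (*-cancelˡ-≡ m (r * d) p (trans pm≡qd (swap r p d)))))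
    where
    swap : ∀ r p d → r * p * d ≡ p * (r * d)
    swap = solve-∀
  ... | inj₂ (divides-refl r) = ∈-++⁺ʳ D (subst (_∈ map (p *_) D) (*-comm p r)
          (∈-map⁺ (p *_) (∈-divisors⁺ (divides q (*-cancelˡ-≡ m (q * r) p (trans pm≡qd (swap q r p)))))))
    where
    swap : ∀ q r p → q * (r * p) ≡ p * (q * r)
    swap = solve-∀

-- Divisor sums of products of large primes

product-primes-nonZero : ∀ {ps} → All Prime ps → NonZero (product ps)
product-primes-nonZero []                  = _
product-primes-nonZero {p ∷ ps} (pr ∷ prs) = m*n≢0 p (product ps) {{prime⇒nonZero pr}} {{product-primes-nonZero prs}}

^length≤product : ∀ {P ps} → All (P ≤_) ps → P ^ length ps ≤ product ps
^length≤product []          = ≤-refl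
^length≤product (P≤p ∷ P≤) = *-mono-≤ P≤p (^length≤product P≤)

-- Each prime factor, counted with multiplicity, contributes at most `(p + 1) / p ≤ (P + 1) / P` to
-- `σ₁(m) / m`; denominators are cleared.
σ₁-product : ∀ {P ps} → All Prime ps → All (P ≤_) ps →
             σ 1 (product ps) * P ^ length ps ≤ product ps * suc P ^ length ps
σ₁-product [] [] = ≤-refl
σ₁-product {P} {p ∷ ps} (pr ∷ prs) (P≤p ∷ P≤) = begin
  σ 1 (p * m) * (P * P ^ l)          ≤⟨ *-monoˡ-≤ (P * P ^ l) (σ₁-prime* m {{product-primes-nonZero prs}} pr) ⟩
  suc p * σ 1 m * (P * P ^ l)        ≡⟨ interchange (suc p) (σ 1 m) P (P ^ l) ⟩
  suc p * P * (σ 1 m * P ^ l)        ≤⟨ *-mono-≤ ratio (σ₁-product prs P≤) ⟩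
  p * suc P * (m * suc P ^ l)        ≡⟨ interchange p (suc P) m (suc P ^ l) ⟩
  p * m * (suc P * suc P ^ l)        ∎
  where
  open ≤-Reasoning
  m = product ps
  l = length ps
  interchange : ∀ a b c d → a * b * (c * d) ≡ a * c * (b * d)
  interchange = solve-∀
  ratio : suc p * P ≤ p * suc P
  ratio = subst (suc p * P ≤_) (sym (*-suc p P)) (+-monoˡ-≤ (p * P) P≤p)

-- With x = j / P this is (1 + 1/P)^j ≤ 1 + x + x², cleared of denominators.
[1+P]^j≤ : ∀ P j → j ≤ P → suc P ^ j * (P * P) ≤ P ^ j * (P * P + j * P + j * j)
[1+P]^j≤ P zero    _   = ≤-reflexive (shape (P * P))
  where
  shape : ∀ x → 1 * x ≡ 1 * (x + 0 + 0)
  shape = solve-∀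
[1+P]^j≤ P (suc j) j<P = begin
  suc P * suc P ^ j * (P * P)                    ≡⟨ *-assoc (suc P) (suc P ^ j) (P * P) ⟩
  suc P * (suc P ^ j * (P * P))                  ≤⟨ *-monoʳ-≤ (suc P) ([1+P]^j≤ P j (<⇒≤ j<P)) ⟩
  suc P * (P ^ j * (P * P + j * P + j * j))      ≡⟨ swap (suc P) (P ^ j) _ ⟩
  P ^ j * (suc P * (P * P + j * P + j * j))      ≤⟨ *-monoʳ-≤ (P ^ j) step ⟩
  P ^ j * (P * (P * P + suc j * P + suc j * suc j))  ≡⟨ regroup (P ^ j) P _ ⟩
  P * P ^ j * (P * P + suc j * P + suc j * suc j)    ∎
  where
  open ≤-Reasoning
  swap : ∀ a b c → a * (b * c) ≡ b * (a * c)
  swap = solve-∀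
  regroup : ∀ a b c → a * (b * c) ≡ b * a * c
  regroup = solve-∀
  expandˡ : ∀ P j → suc P * (P * P + j * P + j * j) ≡ P * (P * P + j * P + j * j + P + j) + j * j
  expandˡ = solve-∀
  expandʳ : ∀ P j → P * (P * P + j * P + j * j + P + j) + (P * j + P) ≡ P * (P * P + suc j * P + suc j * suc j)
  expandʳ = solve-∀
  step : suc P * (P * P + j * P + j * j) ≤ P * (P * P + suc j * P + suc j * suc j)
  step = begin
    suc P * (P * P + j * P + j * j)                   ≡⟨ expandˡ P j ⟩
    -- The two sides differ only in the last summand, and `j * j ≤ P * j` because `j < P`.
    P * (P * P + j * P + j * j + P + j) + j * j       ≤⟨ +-monoʳ-≤ (P * (P * P + j * P + j * j + P + j)) (≤-trans (*-monoˡ-≤ j (<⇒≤ j<P)) (m≤m+n (P * j) P)) ⟩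
    P * (P * P + j * P + j * j + P + j) + (P * j + P) ≡⟨ expandʳ P j ⟩
    P * (P * P + suc j * P + suc j * suc j)           ∎

-- Here `x = j / P` is at most 1, so `1 + x + x²` is at most 3.
[1+P]^j≤3*P^j : ∀ P .{{_ : NonZero P}} j → j ≤ P → suc P ^ j ≤ 3 * P ^ j
[1+P]^j≤3*P^j P j j≤P = *-cancelʳ-≤ _ _ (P * P) {{m*n≢0 P P}} (begin
  suc P ^ j * (P * P)                   ≤⟨ [1+P]^j≤ P j j≤P ⟩
  P ^ j * (P * P + j * P + j * j)       ≤⟨ *-monoʳ-≤ (P ^ j) (+-mono-≤ (+-monoʳ-≤ (P * P) (*-monoˡ-≤ P j≤P)) (*-mono-≤ j≤P j≤P)) ⟩
  P ^ j * (P * P + P * P + P * P)       ≡⟨ shape (P ^ j) (P * P) ⟩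
  3 * P ^ j * (P * P)                   ∎)
  where
  open ≤-Reasoning
  shape : ∀ a b → a * (b + b + b) ≡ 3 * a * b
  shape = solve-∀

-- The harmonic bound

sum-applyUpTo-+ : ∀ f m n → sum (applyUpTo f (m + n)) ≡ sum (applyUpTo f m) + sum (applyUpTo (f ∘ (m +_)) n)
sum-applyUpTo-+ f zero    n = refl
sum-applyUpTo-+ f (suc m) n = trans (cong (f 0 +_) (sum-applyUpTo-+ (f ∘ suc) m n)) (sym (+-assoc (f 0) _ _))

sum-applyUpTo-≤ : ∀ f n c → (∀ i → f i ≤ c) → sum (applyUpTo f n) ≤ n * c
sum-applyUpTo-≤ f zero    c _  = z≤n
sum-applyUpTo-≤ f (suc n) c f≤ = +-mono-≤ (f≤ 0) (sum-applyUpTo-≤ (f ∘ suc) n c (f≤ ∘ suc))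

-- Dyadic blocks: doubling the range from `2 ^ L` adds `2 ^ L` terms, each at most `m / 2 ^ L`,
-- hence at most `m` in total.
sum-/-≤ : ∀ m L → sum (applyUpTo (λ i → m / suc i) (2 ^ L)) ≤ suc L * m
sum-/-≤ m zero    = +-monoˡ-≤ 0 (≤-trans (≤-reflexive (sym (*-identityʳ _))) (m/n*n≤m m 1))
sum-/-≤ m (suc L) = begin
  sum (applyUpTo h (N + (N + 0)))                       ≡⟨ cong (λ t → sum (applyUpTo h (N + t))) (+-identityʳ N) ⟩
  sum (applyUpTo h (N + N))                             ≡⟨ sum-applyUpTo-+ h N N ⟩
  sum (applyUpTo h N) + sum (applyUpTo (h ∘ (N +_)) N)  ≤⟨ +-mono-≤ (sum-/-≤ m L) second-half ⟩
  suc L * m + m                                         ≡⟨ +-comm (suc L * m) m ⟩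
  suc (suc L) * m                                       ∎
  where
  open ≤-Reasoning
  N = 2 ^ L
  h = λ i → m / suc i
  instance _ = m^n≢0 2 L
  second-half : sum (applyUpTo (h ∘ (N +_)) N) ≤ m
  second-half = begin
    sum (applyUpTo (h ∘ (N +_)) N)  ≤⟨ sum-applyUpTo-≤ (h ∘ (N +_)) N (m / N) (λ i → /-monoʳ-≤ m (m≤n⇒m≤1+n (m≤m+n N i))) ⟩
    N * (m / N)                     ≡⟨ *-comm N (m / N) ⟩
    m / N * N                       ≤⟨ m/n*n≤m m N ⟩
    m                               ∎

-- Every divisor is `m` divided by its codivisor, which is at most `m ≤ 2 ^ L`, so it occurs in the
-- harmonic sum.
σ₁≤log : ∀ m .{{_ : NonZero m}} L → m ≤ 2 ^ L → σ 1 m ≤ suc L * m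
σ₁≤log m L m≤2^L = begin
  σ 1 m                                       ≡⟨ σ₁≡sum m ⟩
  sum (divisors m)                            ≤⟨ sum-divisors≤ codivisor ⟩
  sum (applyUpTo (λ i → m / suc i) (2 ^ L))   ≤⟨ sum-/-≤ m L ⟩
  suc L * m                                   ∎
  where
  open ≤-Reasoning
  codivisor : ∀ {d} → d ∣ m → d ∈ applyUpTo (λ i → m / suc i) (2 ^ L)
  codivisor (divides zero    m≡0)  = contradiction m≡0 (≢-nonZero⁻¹ m)
  codivisor {d} d∣m@(divides (suc q) m≡qd) = subst (_∈ applyUpTo (λ i → m / suc i) (2 ^ L))
    (trans (cong (_/ suc q) (trans m≡qd (*-comm (suc q) d))) (m*n/n≡m d (suc q)))
    (∈-applyUpTo⁺ (λ i → m / suc i) (≤-trans (∣⇒≤ (quotient-∣ d∣m)) m≤2^L))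

-- The strict inequality for n ≥ 2

n<2^n : ∀ n → n < 2 ^ n
n<2^n zero    = z<s
n<2^n (suc n) = +-mono-≤ (m^n>0 2 n) (≤-trans (n<2^n n) (m≤m+n (2 ^ n) 0))

-- The left side is the harmonic factor for `B n` with `n ≤ a²`, the right side the growth of `B`
-- over `a + 1` steps. The proof passes through `5 * (a + 1)²` and uses `a + 1 ≤ 2 ^ a`.
1+3a²<5^[1+a] : ∀ a → suc (3 * (a * a)) < 5 ^ suc a
1+3a²<5^[1+a] a = begin-strict
  1 + 3 * (a * a)                    <⟨ +-monoˡ-< (3 * (a * a)) {1} {5} (s≤s (s≤s z≤n)) ⟩
  5 + 3 * (a * a)                    ≤⟨ +-monoʳ-≤ 5 (≤-trans (*-monoˡ-≤ (a * a) {3} {5} (s≤s (s≤s (s≤s z≤n)))) (*-monoʳ-≤ 5 (*-monoʳ-≤ a (n≤1+n a)))) ⟩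
  5 + 5 * (a * suc a)                ≤⟨ +-mono-≤ {5} {5 * suc a} (m≤m*n 5 (suc a)) ≤-refl ⟩
  5 * suc a + 5 * (a * suc a)        ≡⟨ *-distribˡ-+ 5 (suc a) (a * suc a) ⟨
  5 * (suc a * suc a)                ≤⟨ *-monoʳ-≤ 5 (*-mono-≤ (n<2^n a) (n<2^n a)) ⟩
  5 * (2 ^ a * 2 ^ a)                ≡⟨ cong (5 *_) (square a) ⟩
  5 * 4 ^ a                          ≤⟨ *-monoʳ-≤ 5 (^-monoˡ-≤ a (n≤1+n 4)) ⟩
  5 * 5 ^ a                          ∎
  where
  open ≤-Reasoning
  square : ∀ a → 2 ^ a * 2 ^ a ≡ 4 ^ a
  square zero    = refl
  square (suc a) = trans (shape (2 ^ a)) (cong (4 *_) (square a))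
    where
    shape : ∀ x → 2 * x * (2 * x) ≡ 4 * (x * x)
    shape = solve-∀

-- Any factorisation with `1 < b ≤ a` serves: it gives `n ≤ a²` and the three distinct divisors 1,
-- `a` and `n`.
σ₁B<-product : ∀ a b → 1 < b → b ≤ a → σ 1 (B (a * b)) < B (σ 1 (a * b))
σ₁B<-product a b 1<b b≤a = begin-strict
  -- The exponent `3 * n` comes from `B n ≤ 6 ^ n ≤ 8 ^ n`.
  σ 1 m                     ≤⟨ σ₁≤log m (3 * n) m≤ ⟩
  suc (3 * n) * m           ≤⟨ *-monoˡ-≤ m (s≤s (*-monoʳ-≤ 3 (*-monoʳ-≤ a b≤a))) ⟩
  suc (3 * (a * a)) * m     <⟨ *-monoˡ-< m (1+3a²<5^[1+a] a) ⟩
  5 ^ suc a * m             ≤⟨ 5^*B≤B (suc a) n ⟩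
  B (suc a + n)             ≤⟨ B-mono-≤ (σ₁≥ 1<a (m<m*n a b {{>-nonZero (<-trans z<s 1<a)}} 1<b) (m∣m*n b)) ⟩
  B (σ 1 n)                 ∎
  where
  open ≤-Reasoning
  n = a * b
  m = B n
  1<a = <-≤-trans 1<b b≤a
  0<n : 0 < n
  0<n = *-mono-≤ (<⇒≤ 1<a) (<⇒≤ 1<b)
  instance _ = >-nonZero (B-mono-< {0} {n} 0<n)
  m≤ : m ≤ 2 ^ (3 * n)
  m≤ = begin
    B n              ≤⟨ B-mono n ⟩
    B (suc n)        ≤⟨ B≤6^ n ⟩
    6 ^ n            ≤⟨ ^-monoˡ-≤ n (m≤m+n 6 2) ⟩
    (2 ^ 3) ^ n      ≡⟨ ^-*-assoc 2 3 n ⟩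
    2 ^ (3 * n)      ∎

σ₁B<-composite : ∀ {n} → Composite n → σ 1 (B n) < B (σ 1 n)
σ₁B<-composite (composite {d} d<n d∣n@(divides-refl q)) with ≤-total q d
... | inj₁ q≤d = subst (λ n → σ 1 (B n) < B (σ 1 n)) (*-comm d q) (σ₁B<-product d q (quotient>1 d∣n d<n) q≤d)
... | inj₂ d≤q = σ₁B<-product q d (nonTrivial⇒n>1 d) d≤q

σ₁B<-large-prime : ∀ {P} → 6 ≤ P → Prime (suc P) → σ 1 (B (suc P)) < B (σ 1 (suc P))
σ₁B<-large-prime {P} 6≤P n-prime = begin-strict
  σ 1 m                ≤⟨ *-cancelʳ-≤ _ _ (P ^ l) σ₁*P^l≤ ⟩
  3 * m                <⟨ *-monoˡ-< m {3} {5} (s≤s (s≤s (s≤s (s≤s z≤n)))) ⟩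
  5 * m                ≤⟨ B-suc-≥ (suc P) ⟩
  B (suc (suc P))      ≤⟨ B-mono-≤ (subst (λ t → suc t ≤ σ 1 (suc P)) (*-identityʳ (suc P)) (σ≥1+^ 1 (s≤s (≤-trans z<s 6≤P)))) ⟩
  B (σ 1 (suc P))      ∎
  where
  open ≤-Reasoning
  m = B (suc P)
  instance
    m≢0 = >-nonZero (B-pos P)
    P≢0 = >-nonZero (≤-trans z<s 6≤P)
  open PrimeFactorisation (factorise m)
  l = length factors
  instance _ = m^n≢0 P l
  large : All (P ≤_) factors
  large = All.tabulate λ {p} p∈ → prime∣B[prime]⇒≥ n-prime (All.lookup factorsPrime p∈)
    (subst (p ∣_) (sym isFactorisation) (∈⇒∣product p∈))
  -- This bounds the number `l` of prime factors: each is at least `P ≥ 6`, while `m` is at most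
  -- `6 ^ P`.
  6^l≤6^P : 6 ^ l ≤ 6 ^ P
  6^l≤6^P = begin
    6 ^ l            ≤⟨ ^-monoˡ-≤ l 6≤P ⟩
    P ^ l            ≤⟨ ^length≤product large ⟩
    product factors  ≡⟨ isFactorisation ⟨
    m                ≤⟨ B≤6^ P ⟩
    6 ^ P            ∎
  l≤P : l ≤ P
  l≤P = ≮⇒≥ λ P<l → <⇒≱ (^-monoʳ-< 6 (s≤s z<s) P<l) 6^l≤6^P
  σ₁*P^l≤ : σ 1 m * P ^ l ≤ 3 * m * P ^ l
  σ₁*P^l≤ = begin
    σ 1 m * P ^ l      ≤⟨ subst (λ t → σ 1 t * P ^ l ≤ t * suc P ^ l) (sym isFactorisation) (σ₁-product factorsPrime large) ⟩
    m * suc P ^ l      ≤⟨ *-monoʳ-≤ m ([1+P]^j≤3*P^j P l l≤P) ⟩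
    m * (3 * P ^ l)    ≡⟨ shape m (P ^ l) ⟩
    3 * m * P ^ l      ∎
    where
    shape : ∀ a b → a * (3 * b) ≡ 3 * a * b
    shape = solve-∀

σ₁B< : ∀ n → 2 ≤ n → σ 1 (B n) < B (σ 1 n)
σ₁B< n 2≤n with composite? n
... | yes n-composite = σ₁B<-composite n-composite
σ₁B< 1 (s≤s ()) | no _
-- For the primes 2, 3 and 5 the predecessor is below 6, so the values are computed.
σ₁B< 2 _ | no _ = from-yes (σ 1 (B 2) <? B (σ 1 2))
σ₁B< 3 _ | no _ = from-yes (σ 1 (B 3) <? B (σ 1 3))
σ₁B< 4 _ | no ¬composite = contradiction composite[4] ¬composite
σ₁B< 5 _ | no _ = from-yes (σ 1 (B 5) <? B (σ 1 5))
σ₁B< 6 _ | no ¬composite = contradiction composite[6] ¬composite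
σ₁B< (suc (suc (suc (suc (suc (suc (suc n))))))) _ | no ¬composite =
  σ₁B<-large-prime (m≤m+n 6 n) (prime ¬composite)

-- The trivial bounds turn both sides into values of `B`, so it suffices to compare the indices
-- `suc k * n` and `1 + n ^ k`; the 1 gives strictness.
σB<-power : ∀ k n → 2 ≤ n → suc k * n ≤ n ^ k → σ k (B n) < B (σ k n)
σB<-power k n 2≤n [1+k]n≤n^k = begin-strict
  σ k (B n)         ≤⟨ σ≤^ k (B n) {{>-nonZero (B-mono-< (≤-trans z<s 2≤n))}} ⟩
  B n ^ suc k       ≤⟨ B^≤B n k ⟩
  B (suc k * n)     <⟨ B-mono-< (s≤s [1+k]n≤n^k) ⟩
  B (1 + n ^ k)     ≤⟨ B-mono-≤ (σ≥1+^ k 2≤n) ⟩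
  B (σ k n)         ∎
  where open ≤-Reasoning

-- The left side at most doubles, while the right side is multiplied by `n ≥ 2`.
*≤^-step : ∀ k n → 2 ≤ n → suc k * n ≤ n ^ k → suc (suc k) * n ≤ n ^ suc k
*≤^-step k n 2≤n ih = begin
  suc (suc k) * n      ≤⟨ *-monoˡ-≤ n (m≤m+n (suc (suc k)) k) ⟩
  (suc (suc k) + k) * n ≡⟨ shape k n ⟩
  2 * (suc k * n)      ≤⟨ *-mono-≤ 2≤n ih ⟩
  n * n ^ k            ∎
  where
  open ≤-Reasoning
  shape : ∀ k n → (suc (suc k) + k) * n ≡ 2 * (suc k * n)
  shape = solve-∀

3+k*n≤n^2+k : ∀ k n → 3 ≤ n → (3 + k) * n ≤ n ^ (2 + k)
3+k*n≤n^2+k zero    n 3≤n = *-mono-≤ 3≤n (≤-reflexive (sym (*-identityʳ n)))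
3+k*n≤n^2+k (suc k) n 3≤n = *≤^-step (2 + k) n (<⇒≤ 3≤n) (3+k*n≤n^2+k k n 3≤n)

-- For `n = 2` the induction starts at exponent 3, with equality `8 = 8`.
4+k*2≤2^3+k : ∀ k → (4 + k) * 2 ≤ 2 ^ (3 + k)
4+k*2≤2^3+k zero    = ≤-refl
4+k*2≤2^3+k (suc k) = *≤^-step (3 + k) 2 ≤-refl (4+k*2≤2^3+k k)

σB< : ∀ k n → 1 ≤ k → 2 ≤ n → σ k (B n) < B (σ k n)
σB< 1                   n _ 2≤n = σ₁B< n 2≤n
σB< (suc (suc k))       1 _ (s≤s ())
-- The index comparison fails here, as `3 * 2 > 2 ^ 2`, so the values are computed.
σB< 2                   2 _ _   = from-yes (σ 2 (B 2) <? B (σ 2 2))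
σB< (suc (suc (suc k))) 2 _ 2≤n = σB<-power (3 + k) 2 2≤n (4+k*2≤2^3+k k)
σB< (suc (suc k))       n@(suc (suc (suc _))) _ 2≤n =
  σB<-power (2 + k) n 2≤n (3+k*n≤n^2+k k n (s≤s (s≤s (s≤s z≤n))))

σ[1]≡1 : ∀ k → σ k 1 ≡ 1
σ[1]≡1 k = trans (+-identityʳ (1 ^ k)) (^-zeroˡ k)

theorem3p1 : (k : ℕ) → 1 ≤ k → (n : ℕ) → 1 ≤ n → (σ k (B n) ≤ B (σ k n)) × (σ k (B n) ≡ B (σ k n) → n ≡ 1)
theorem3p1 k 1≤k 1               _ = ≤-reflexive (trans (σ[1]≡1 k) (sym (cong B (σ[1]≡1 k)))) , λ _ → refl
theorem3p1 k 1≤k n@(suc (suc _)) _ = <⇒≤ strict , λ eq → contradiction eq (<⇒≢ strict)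
  where strict = σB< k n 1≤k (s≤s (s≤s z≤n))
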